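{- Let $G=(V,E)$ be a graph which is an $n$-convex geometry. The following facts are equivalent: (i) $G$ is quasi-threshold; (ii) $G$ is isomorphic to one of $K_1$, $2K_1$, $P_3$; (iii) $G$ is threshold. In particular, if $|V|\geq 4$, then $G$ admits an induced subgraph isomorphic to $P_4$ or an induced subgraph isomorphic to $C_4$.
   Context: All graphs are finite, simple and undirected, with non-empty vertex set. $K_1$ is the one-vertex graph, $2K_1$ the graph on two vertices with no edge, $2K_2$ the disjoint union of two edges, $P_k$ the path on $k$ vertices, $C_k$ the cycle on $k$ vertices. A graph is quasi-threshold if it has no induced subgraph isomorphic to $P_4$ or $C_4$; it is threshold if it has no induced subgraph isomorphic to $P_4$, $C_4$ or $2K_2$. For a graph $G=(V,E)$ and $x\in V$, the closed neighbourhood of $x$ is $N[x]=\{x\}\cup\{y\in V:\{x,y\}\in E\}$. For $Y\subseteq V$, the common closed neighbourhood is $N[Y]=\bigcap_{y\in Y}N[y]$ if $Y\neq\varnothing$, and $N[\varnothing]=V$. The neighbourhood convexity of $G$ is the family $n_G=\{N[Y]:Y\subseteq V\}\cup\{\varnothing\}$ of subsets of $V$; it contains $\varnothing$ and $V$ and is closed under intersection. Its members are called $n$-convex sets. For $X\subseteq V$ the convex hull $[X]_{n}$ is the intersection of all $n$-convex sets containing $X$. For an $n$-convex set $K$, $\operatorname{ex}(K)=\{x\in K: K\setminus\{x\}\in n_G\}$ is the set of extreme points of $K$. $G$ is an $n$-convex geometry if $K=[\operatorname{ex}(K)]_{n}$ for every $n$-convex set $K$. -}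

module Defs where

open import Data.Empty using () renaming (⊥ to Absurd)
open import Data.Fin using (Fin; toℕ)
import Data.Fin as Fin
open import Data.Fin.Subset using (Subset; _∈_; _-_; Empty)
open import Data.Nat using (ℕ; suc; _≤_; z≤n; s≤s; _≟_)
open import Data.Nat.Properties using (1+n≢n)
open import Data.Product using (Σ-syntax; ∃-syntax; _×_; _,_; proj₁)
open import Data.Sum using (_⊎_; inj₁; inj₂; swap)
open import Data.Sum.Relation.Binary.Pointwise
  using (Pointwise; inj₁; inj₂; ⊎-symmetric; ⊎-decidable)
open import Function using (_on_)
open import Level using (0ℓ)
open import Relation.Binary using (Rel; Symmetric; Decidable)
open import Relation.Binary.Morphism.Structures using (IsOrderIsomorphism)
open import Relation.Binary.PropositionalEquality using (_≡_; refl; sym; subst)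
open import Relation.Nullary using (¬_; yes; no)
open import Relation.Nullary.Decidable using (_⊎-dec_; _×-dec_; ¬?)
open import Relation.Unary using (Pred; _⊆_; _≐_)

-- Finiteness is not part of the record: the ambient graph is always a
-- `Graph (Fin n)`.  Decidability of adjacency makes it an ordinary
-- {0,1}-valued adjacency matrix.
record Graph (V : Set) : Set₁ where
  field
    Adj   : Rel V 0ℓ
    adj?  : Decidable Adj
    adj-sym    : Symmetric Adj
    adj-irrefl : ∀ {x} → ¬ Adj x x

open Graph

-- `IsOrderIsomorphism` assumes no order laws: it says that f is bijective
-- (for _≡_) and both preserves and reflects adjacency.
infix 4 _≅_
_≅_ : ∀ {V W} → Graph V → Graph W → Set
G ≅ H = ∃[ f ] IsOrderIsomorphism _≡_ _≡_ (Adj G) (Adj H) f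

induced : ∀ {n} → Graph (Fin n) → (S : Subset n) → Graph (Σ[ x ∈ Fin n ] x ∈ S)
induced G S = record
  { Adj        = Adj G on proj₁
  ; adj?       = λ x y → adj? G (proj₁ x) (proj₁ y)
  ; adj-sym    = adj-sym G
  ; adj-irrefl = adj-irrefl G
  }

HasInduced : ∀ {n W} → Graph (Fin n) → Graph W → Set
HasInduced G H = ∃[ S ] induced G S ≅ H

edgeless : ∀ n → Graph (Fin n)
edgeless n = record
  { Adj        = λ _ _ → Absurd
  ; adj?       = λ _ _ → no λ ()
  ; adj-sym    = λ ()
  ; adj-irrefl = λ ()
  }

complete : ∀ n → Graph (Fin n)
complete n = record
  { Adj        = λ x y → ¬ x ≡ y
  ; adj?       = λ x y → ¬? (x Fin.≟ y)
  ; adj-sym    = λ x≢y y≡x → x≢y (sym y≡x)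
  ; adj-irrefl = λ x≢x → x≢x refl
  }

path : ∀ k → Graph (Fin k)
path k = record
  { Adj        = λ x y → Next x y ⊎ Next y x
  ; adj?       = λ x y → next? x y ⊎-dec next? y x
  ; adj-sym    = swap
  ; adj-irrefl = λ { (inj₁ e) → 1+n≢n e ; (inj₂ e) → 1+n≢n e }
  }
  where
  Next : Rel (Fin k) 0ℓ
  Next x y = suc (toℕ x) ≡ toℕ y

  next? : Decidable Next
  next? x y = suc (toℕ x) ≟ toℕ y

cycle : ∀ k → 3 ≤ k → Graph (Fin k)
cycle k 3≤k = record
  { Adj        = λ x y → Next x y ⊎ Next y x
  ; adj?       = λ x y → next? x y ⊎-dec next? y x
  ; adj-sym    = swap
  ; adj-irrefl = λ { (inj₁ e) → next-irrefl e ; (inj₂ e) → next-irrefl e }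
  }
  where
  Next : Rel (Fin k) 0ℓ
  Next x y = suc (toℕ x) ≡ toℕ y ⊎ (suc (toℕ x) ≡ k × toℕ y ≡ 0)

  next? : Decidable Next
  next? x y = (suc (toℕ x) ≟ toℕ y) ⊎-dec ((suc (toℕ x) ≟ k) ×-dec (toℕ y ≟ 0))

  next-irrefl : ∀ {x} → ¬ Next x x
  next-irrefl (inj₁ e) = 1+n≢n e
  next-irrefl {x} (inj₂ (last , first)) with toℕ x
  next-irrefl (inj₂ (last , refl)) | .0 with subst (3 ≤_) (sym last) 3≤k
  ... | s≤s ()

infixr 6 _⊎ᴳ_
_⊎ᴳ_ : ∀ {V W} → Graph V → Graph W → Graph (V ⊎ W)
G ⊎ᴳ H = record
  { Adj        = Pointwise (Adj G) (Adj H)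
  ; adj?       = ⊎-decidable (adj? G) (adj? H)
  ; adj-sym    = ⊎-symmetric (adj-sym G) (adj-sym H)
  ; adj-irrefl = λ { (inj₁ e) → adj-irrefl G e ; (inj₂ e) → adj-irrefl H e }
  }

K₁ : Graph (Fin 1)
K₁ = complete 1

2K₁ : Graph (Fin 2)
2K₁ = edgeless 2

2K₂ : Graph (Fin 2 ⊎ Fin 2)
2K₂ = complete 2 ⊎ᴳ complete 2

P₃ : Graph (Fin 3)
P₃ = path 3

P₄ : Graph (Fin 4)
P₄ = path 4

C₄ : Graph (Fin 4)
C₄ = cycle 4 (s≤s (s≤s (s≤s z≤n)))

module _ {n} (G : Graph (Fin n)) where

  QuasiThreshold : Set
  QuasiThreshold = ¬ HasInduced G P₄ × ¬ HasInduced G C₄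

  Threshold : Set
  Threshold = ¬ HasInduced G P₄ × ¬ HasInduced G C₄ × ¬ HasInduced G 2K₂

  N[_] : Fin n → Pred (Fin n) 0ℓ
  N[ x ] y = y ≡ x ⊎ Adj G x y

  -- For empty Y the condition is vacuous, so the value is the whole vertex set.
  CommonN[_] : Subset n → Pred (Fin n) 0ℓ
  CommonN[ Y ] z = ∀ {y} → y ∈ Y → N[ y ] z

  -- NConvex K is the membership K ∈ n_G; the second disjunct adjoins ∅ to the
  -- family, since ∅ need not be a common neighbourhood.
  NConvex : Subset n → Set
  NConvex K = (∃[ Y ] (_∈ K) ≐ CommonN[ Y ]) ⊎ Empty K

  hull : Pred (Fin n) 0ℓ → Pred (Fin n) 0ℓ
  hull X z = ∀ K → NConvex K → X ⊆ (_∈ K) → z ∈ K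

  ex : Subset n → Pred (Fin n) 0ℓ
  ex K x = x ∈ K × NConvex (K - x)

  IsNConvexGeometry : Set
  IsNConvexGeometry = ∀ K → NConvex K → (_∈ K) ≐ hull (ex K)

{-# OPTIONS --safe #-}
-- Let x be an extreme point of V.  Unless V = {x}, some y is adjacent to everything
-- except x.  Without induced P₄ and C₄ every neighbour z of x is universal, since a
-- non-neighbour w of z would close an induced P₄ or C₄ on x, z, y, w.  There is a
-- second extreme point x′ ≠ x, since otherwise the hull of ex(V) would lie in N[x],
-- which misses y.  The vertex y′ missing only x′ is not a neighbour of x, so y′ = x,
-- x′ = y, and V consists of x, y and universal vertices.  The set of universal
-- vertices is convex and contained in every N[Y], so by its extreme points it has at
-- most one element.
module Submission where

open import Defs
open import Data.Fin using (Fin; fromℕ<; splitAt; join)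
import Data.Fin as Fin
open import Data.Fin.Patterns using (0F; 1F; 2F; 3F)
open import Data.Fin.Properties using (any?; all?; <-cmp; injective⇒≤; join-splitAt)
open import Data.Fin.Subset using (Subset; _∈_; _∉_; _-_; ⊤; ⊥; ⁅_⁆)
open import Data.Fin.Subset.Properties
  using (_∈?_; nonempty?; anySubset?; ∈⊤; ∉⊥; x∈⁅x⁆; x∈⁅y⁆⇒x≡y; x∈p∧x≢y⇒x∈p-y)
open import Data.Nat using (ℕ; NonZero; _≤_; s≤s; z≤n; >-nonZero⁻¹)
open import Data.Nat.Properties using (≤-trans; ≤⇒≯)
open import Data.Product using (Σ-syntax; ∃-syntax; _×_; _,_; proj₁; proj₂)
open import Data.Sum using (_⊎_; inj₁; inj₂; [_,_])
open import Data.Vec using ([]; _∷_; there; lookup; tabulate)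
open import Data.Vec.Properties using (lookup∘tabulate; []=⇒lookup; lookup⇒[]=)
open import Data.Vec.Properties.WithK using ([]=-irrelevant)
open import Function using (_∘_; id)
open import Function.Bundles using (_⇔_; mk⇔)
open import Function.Definitions using (Injective)
open import Level using (0ℓ)
open import Relation.Binary using (tri<; tri≈; tri>)
open import Relation.Binary.Morphism.Structures using (module IsOrderIsomorphism)
open import Relation.Binary.PropositionalEquality
  using (_≡_; _≢_; refl; sym; trans; cong; subst)
open import Relation.Nullary using (Dec; ¬_; yes; no; contradiction)
open import Relation.Nullary.Decidable
  using (True; False; toWitness; toWitnessFalse; does; map′; decidable-stable;
         dec-true; _→-dec_; _×-dec_; _⊎-dec_; ¬?)
open import Relation.Unary using (Pred; Decidable; _⊆_; _≐_)

open Graph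

-- Subsets cut out by decidable predicates

module _ {n} {P : Pred (Fin n) 0ℓ} (P? : Decidable P) where

  comprehension : Subset n
  comprehension = tabulate (does ∘ P?)

  ∈-comprehension : (_∈ comprehension) ≐ P
  ∈-comprehension = to , from
    where
    to : (_∈ comprehension) ⊆ P
    to {x} x∈ with P? x | trans (sym (lookup∘tabulate (does ∘ P?) x)) ([]=⇒lookup x∈)
    ... | yes px | _ = px

    from : P ⊆ (_∈ comprehension)
    from {x} px =
      lookup⇒[]= x _ (trans (lookup∘tabulate (does ∘ P?) x) (dec-true (P? x) px))

≐? : ∀ {n} {P Q : Pred (Fin n) 0ℓ} → Decidable P → Decidable Q → Dec (P ≐ Q)
≐? P? Q? = ⊆? P? Q? ×-dec ⊆? Q? P?
  where
  ⊆? : ∀ {n} {P Q : Pred (Fin n) 0ℓ} → Decidable P → Decidable Q → Dec (P ⊆ Q)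
  ⊆? P? Q? = map′ (λ f {x} → f x) (λ f x → f {x}) (all? (λ x → P? x →-dec Q? x))

x∉p-x : ∀ {n} (p : Subset n) x → x ∉ p - x
x∉p-x (_ ∷ p) Fin.zero    ()
x∉p-x (_ ∷ p) (Fin.suc x) (there x∈) = x∉p-x p x x∈

-- Membership proofs are unique, so a vertex of an induced subgraph is determined by the underlying
-- vertex.
∈-Σ-≡ : ∀ {n} {S : Subset n} {u v : Σ[ x ∈ Fin n ] x ∈ S} → proj₁ u ≡ proj₁ v → u ≡ v
∈-Σ-≡ {u = x , p} {v = .x , q} refl = cong (x ,_) ([]=-irrelevant p q)

-- Isomorphisms and induced subgraphs from lists of vertices

-- Demanded below only for `i < j`: symmetry and irreflexivity of adjacency take care of the other
-- pairs.
record Matches {V : Set} {k} (G : Graph V) (H : Graph (Fin k)) (f : Fin k → V)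
               (i j : Fin k) : Set where
  constructor matches
  field
    distinct : f i ≢ f j
    to       : Adj G (f i) (f j) → Adj H i j
    from     : Adj H i j → Adj G (f i) (f j)

module _ {V : Set} {k} {G : Graph V} {H : Graph (Fin k)} {f : Fin k → V} {i j : Fin k} where

  -- At concrete indices the `True` argument is solved by evaluation, so adjacency in `H` needs no
  -- proof.
  edge : {_ : True (adj? H i j)} → Adj G (f i) (f j) → Matches G H f i j
  edge {h} e = matches (λ eq → adj-irrefl G (subst (Adj G (f i)) (sym eq) e))
                       (λ _ → toWitness h) (λ _ → e)

  non-edge : {_ : False (adj? H i j)} → f i ≢ f j → ¬ Adj G (f i) (f j) → Matches G H f i j
  non-edge {h} ne ¬e =
    matches ne (λ e → contradiction e ¬e) (λ e → contradiction e (toWitnessFalse h))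

module _ {V : Set} {k} (G : Graph V) (H : Graph (Fin k)) (f : Fin k → V)
         (match : ∀ {i j} → i Fin.< j → Matches G H f i j) where

  matching-injective : Injective _≡_ _≡_ f
  matching-injective {i} {j} eq with <-cmp i j
  ... | tri< i<j _ _ = contradiction eq (Matches.distinct (match i<j))
  ... | tri≈ _ i≡j _ = i≡j
  ... | tri> _ _ j<i = contradiction (sym eq) (Matches.distinct (match j<i))

  matching-to : ∀ i j → Adj G (f i) (f j) → Adj H i j
  matching-to i j e with <-cmp i j
  ... | tri< i<j _ _  = Matches.to (match i<j) e
  ... | tri≈ _ refl _ = contradiction e (adj-irrefl G)
  ... | tri> _ _ j<i  = adj-sym H (Matches.to (match j<i) (adj-sym G e))

  matching-from : ∀ i j → Adj H i j → Adj G (f i) (f j)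
  matching-from i j e with <-cmp i j
  ... | tri< i<j _ _  = Matches.from (match i<j) e
  ... | tri≈ _ refl _ = contradiction e (adj-irrefl H)
  ... | tri> _ _ j<i  = adj-sym G (Matches.from (match j<i) (adj-sym H e))

  -- The isomorphism is the inverse of `f`, read off from surjectivity.
  matching⇒≅ : (∀ v → ∃[ i ] f i ≡ v) → G ≅ H
  matching⇒≅ onto = index , record
    { isOrderMonomorphism = record
      { isOrderHomomorphism = record
        { cong = cong index
        ; mono = λ {u} {v} e → matching-to _ _ (subst₂-Adj (sym (eq u)) (sym (eq v)) e)
        }
      ; injective = λ {u} {v} e → trans (sym (eq u)) (trans (cong f e) (eq v))
      ; cancel    = λ {u} {v} e → subst₂-Adj (eq u) (eq v) (matching-from _ _ e)
      }
    ; surjective = λ i → f i , λ { refl → matching-injective (eq (f i)) }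
    }
    where
    index : V → Fin k
    index = proj₁ ∘ onto

    eq : ∀ v → f (index v) ≡ v
    eq = proj₂ ∘ onto

    subst₂-Adj : ∀ {u u′ v v′} → u ≡ u′ → v ≡ v′ → Adj G u v → Adj G u′ v′
    subst₂-Adj refl refl e = e

matching⇒HasInduced : ∀ {n k} (G : Graph (Fin n)) (H : Graph (Fin k)) (f : Fin k → Fin n) →
  (∀ {i j} → i Fin.< j → Matches G H f i j) → HasInduced G H
matching⇒HasInduced G H f match =
  S , matching⇒≅ (induced G S) H f′ match′ onto
  where
  image? : Decidable (λ x → ∃[ i ] f i ≡ x)
  image? x = any? (λ i → f i Fin.≟ x)

  S = comprehension image?

  f′ = λ i → f i , proj₂ (∈-comprehension image?) (i , refl)

  match′ : ∀ {i j} → i Fin.< j → Matches (induced G S) H f′ i j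
  match′ i<j = matches (λ e → distinct (cong proj₁ e)) to from
    where open Matches (match i<j)

  onto : ∀ v → ∃[ i ] f′ i ≡ v
  onto (x , x∈S) with i , fi≡x ← proj₁ (∈-comprehension image?) x∈S = i , ∈-Σ-≡ fi≡x

-- Bounds on the number of vertices

≅⇒≤ : ∀ {m n} (G : Graph (Fin m)) (H : Graph (Fin n)) → G ≅ H → m ≤ n
≅⇒≤ G H (f , iso) = injective⇒≤ (IsOrderIsomorphism.injective iso)

-- The map `h` allows vertex types other than `Fin`, as for `2K₂`; its values, pulled back along the
-- isomorphism, stay distinct in `G`.
HasInduced⇒≤ : ∀ {n m W} (G : Graph (Fin n)) (H : Graph W) {h : Fin m → W} →
  Injective _≡_ _≡_ h → HasInduced G H → m ≤ n
HasInduced⇒≤ G H {h} h-inj (S , f , iso) = injective⇒≤ {f = proj₁ ∘ section} λ {i} {j} eq →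
  h-inj (trans (sym (f-section i)) (trans (cong f (∈-Σ-≡ eq)) (f-section j)))
  where
  section = λ i → proj₁ (IsOrderIsomorphism.surjective iso (h i))

  f-section : ∀ i → f (section i) ≡ h i
  f-section i = proj₂ (IsOrderIsomorphism.surjective iso (h i)) refl

splitAt-injective : ∀ m {n} → Injective _≡_ _≡_ (splitAt m {n})
splitAt-injective m {n} {i} {j} eq =
  trans (sym (join-splitAt m n i)) (trans (cong (join m n) eq) (join-splitAt m n j))

module _ {n} (G : Graph (Fin n)) where

  Small : Set
  Small = G ≅ K₁ ⊎ G ≅ 2K₁ ⊎ G ≅ P₃

  Small⇒≤3 : Small → n ≤ 3
  Small⇒≤3 (inj₁ iso)        = ≤-trans (≅⇒≤ G K₁ iso) (s≤s z≤n)
  Small⇒≤3 (inj₂ (inj₁ iso)) = ≤-trans (≅⇒≤ G 2K₁ iso) (s≤s (s≤s z≤n))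
  Small⇒≤3 (inj₂ (inj₂ iso)) = ≅⇒≤ G P₃ iso

  Small⇒Threshold : Small → Threshold G
  Small⇒Threshold small =
    too-small ∘ HasInduced⇒≤ G P₄ id ,
    too-small ∘ HasInduced⇒≤ G C₄ id ,
    too-small ∘ HasInduced⇒≤ G 2K₂ (splitAt-injective 2)
    where
    too-small : ¬ 4 ≤ n
    too-small = ≤⇒≯ (Small⇒≤3 small)

  -- Decidable convexity and universal vertices

  N? : ∀ x → Decidable (N[_] G x)
  N? x y = (y Fin.≟ x) ⊎-dec adj? G x y

  CommonN? : ∀ Y → Decidable (CommonN[_] G Y)
  CommonN? Y z =
    map′ (λ f {y} → f y) (λ f y → f {y}) (all? (λ y → (y ∈? Y) →-dec N? y z))

  -- Only finitely many `Y` have to be tried. Extreme points can therefore be found by search.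
  NConvex? : Decidable (NConvex G)
  NConvex? K = anySubset? (λ Y → ≐? (_∈? K) (CommonN? Y)) ⊎-dec ¬? (nonempty? K)

  ex? : ∀ K → Decidable (ex G K)
  ex? K x = (x ∈? K) ×-dec NConvex? (K - x)

  common : Subset n → Subset n
  common Y = comprehension (CommonN? Y)

  common-NConvex : ∀ Y → NConvex G (common Y)
  common-NConvex Y = inj₁ (Y , ∈-comprehension (CommonN? Y))

  ⊤-NConvex : NConvex G ⊤
  ⊤-NConvex = inj₁ (⊥ , (λ _ y∈⊥ → contradiction y∈⊥ ∉⊥) , λ _ → ∈⊤)

  ⊥-NConvex : NConvex G ⊥
  ⊥-NConvex = inj₂ (λ (_ , x∈⊥) → ∉⊥ x∈⊥)

  Universal : Pred (Fin n) 0ℓ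
  Universal u = ∀ z → N[_] G u z

  -- This is N[V], the smallest of all common closed neighbourhoods.
  universals : Subset n
  universals = common ⊤

  N-sym : ∀ {x y} → N[_] G x y → N[_] G y x
  N-sym (inj₁ eq) = inj₁ (sym eq)
  N-sym (inj₂ e)  = inj₂ (adj-sym G e)

  ∈-universals : (_∈ universals) ≐ Universal
  ∈-universals =
    (λ u∈ z → N-sym (proj₁ (∈-comprehension (CommonN? ⊤)) u∈ ∈⊤)) ,
    (λ u → proj₂ (∈-comprehension (CommonN? ⊤)) (λ {y} _ → N-sym (u y)))

  -- Extreme points of the whole vertex set

  MissesOnly : Fin n → Fin n → Set
  MissesOnly y x = ¬ N[_] G y x × (∀ {z} → z ≢ x → N[_] G y z)

  -- If V without `x` is N[Y], then `x` is outside N[y] for some `y` in `Y`, while N[y] contains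
  -- N[Y], that is, everything else.
  extreme-point : ∀ {x} → ex G ⊤ x → (∀ z → z ≡ x) ⊎ (∃[ y ] MissesOnly y x)
  extreme-point {x} (_ , inj₂ empty) = inj₁ λ z →
    decidable-stable (z Fin.≟ x) λ z≢x → empty (z , x∈p∧x≢y⇒x∈p-y ∈⊤ z≢x)
  extreme-point {x} (_ , inj₁ (Y , to , from))
    with any? (λ y → (y ∈? Y) ×-dec ¬? (N? y x))
  ... | yes (y , y∈Y , ¬Nyx) =
        inj₂ (y , ¬Nyx , λ z≢x → to (x∈p∧x≢y⇒x∈p-y ∈⊤ z≢x) y∈Y)
  ... | no none = contradiction
        (from λ {y} y∈Y → decidable-stable (N? y x) λ ¬Nyx → none (y , y∈Y , ¬Nyx))
        (x∉p-x ⊤ x)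

  -- Induced four-vertex paths and cycles

  Obstructed : Set
  Obstructed = HasInduced G P₄ ⊎ HasInduced G C₄

  -- Each hypothesis `¬ N[_]` provides both distinctness and non-adjacency of a pair.
  induced-P₄ : ∀ {a b c d} → Adj G a b → Adj G b c → Adj G c d →
    ¬ N[_] G c a → ¬ N[_] G d a → ¬ N[_] G d b → HasInduced G P₄
  induced-P₄ {a} {b} {c} {d} ab bc cd ac ad bd = matching⇒HasInduced G P₄ f match
    where
    f = lookup (a ∷ b ∷ c ∷ d ∷ [])

    match : ∀ {i j} → i Fin.< j → Matches G P₄ f i j
    match {0F} {1F} _ = edge ab
    match {0F} {2F} _ = non-edge (ac ∘ inj₁) (ac ∘ inj₂ ∘ adj-sym G)
    match {0F} {3F} _ = non-edge (ad ∘ inj₁) (ad ∘ inj₂ ∘ adj-sym G)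
    match {1F} {2F} _ = edge bc
    match {1F} {3F} _ = non-edge (bd ∘ inj₁) (bd ∘ inj₂ ∘ adj-sym G)
    match {2F} {3F} _ = edge cd
    -- In the remaining pairs `i < j` fails, which shows only after peeling off successors.
    match {1F} {1F} (s≤s ())
    match {2F} {1F} (s≤s ())
    match {2F} {2F} (s≤s (s≤s ()))
    match {3F} {1F} (s≤s ())
    match {3F} {2F} (s≤s (s≤s ()))
    match {3F} {3F} (s≤s (s≤s (s≤s ())))

  induced-C₄ : ∀ {a b c d} → Adj G a b → Adj G b c → Adj G c d → Adj G d a →
    ¬ N[_] G c a → ¬ N[_] G d b → HasInduced G C₄
  induced-C₄ {a} {b} {c} {d} ab bc cd da ac bd = matching⇒HasInduced G C₄ f match
    where
    f = lookup (a ∷ b ∷ c ∷ d ∷ [])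

    match : ∀ {i j} → i Fin.< j → Matches G C₄ f i j
    match {0F} {1F} _ = edge ab
    match {0F} {2F} _ = non-edge (ac ∘ inj₁) (ac ∘ inj₂ ∘ adj-sym G)
    match {0F} {3F} _ = edge (adj-sym G da)
    match {1F} {2F} _ = edge bc
    match {1F} {3F} _ = non-edge (bd ∘ inj₁) (bd ∘ inj₂ ∘ adj-sym G)
    match {2F} {3F} _ = edge cd
    match {1F} {1F} (s≤s ())
    match {2F} {1F} (s≤s ())
    match {2F} {2F} (s≤s (s≤s ()))
    match {3F} {1F} (s≤s ())
    match {3F} {2F} (s≤s (s≤s ()))
    match {3F} {3F} (s≤s (s≤s (s≤s ())))

  non-universal-neighbour⇒obstructed : ∀ {x y z w} → MissesOnly y x → Adj G x z →
    ¬ N[_] G z w → Obstructed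
  non-universal-neighbour⇒obstructed {x} {y} {z} {w} (¬Nyx , Ny) xz ¬Nzw =
    obstruction (adj? G x w)
    where
    z≢x : z ≢ x
    z≢x refl = adj-irrefl G xz

    w≢x : w ≢ x
    w≢x refl = ¬Nzw (inj₂ (adj-sym G xz))

    -- Here `z = y` is excluded because `z` is adjacent to `x`; below, `w = y` because `z` is
    -- adjacent to `y`.
    yz : Adj G y z
    yz with Ny z≢x
    ... | inj₁ refl = contradiction (inj₂ (adj-sym G xz)) ¬Nyx
    ... | inj₂ e    = e

    yw : Adj G y w
    yw with Ny w≢x
    ... | inj₁ refl = contradiction (inj₂ (adj-sym G yz)) ¬Nzw
    ... | inj₂ e    = e

    -- On the path `x`, `z`, `y`, `w` only the pair of ends is undecided: an edge there gives C₄, a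
    -- non-edge P₄.
    obstruction : Dec (Adj G x w) → Obstructed
    obstruction (yes xw) = inj₂ (induced-C₄ xz (adj-sym G yz) yw (adj-sym G xw)
                                  ¬Nyx (¬Nzw ∘ N-sym))
    obstruction (no ¬xw) = inj₁ (induced-P₄ xz (adj-sym G yz) yw ¬Nyx
                                  [ w≢x ∘ sym , ¬xw ∘ adj-sym G ] (¬Nzw ∘ N-sym))

  neighbours-universal : ∀ {x y} → MissesOnly y x →
    Obstructed ⊎ (∀ {z} → Adj G x z → Universal z)
  neighbours-universal {x} m
    with any? (λ z → adj? G x z ×-dec any? (λ w → ¬? (N? z w)))
  ... | yes (z , xz , w , ¬Nzw) = inj₁ (non-universal-neighbour⇒obstructed m xz ¬Nzw)
  ... | no none = inj₂ λ {z} xz w → decidable-stable (N? z w) λ ¬Nzw → none (z , xz , w , ¬Nzw)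

  -- Consequences of the convex geometry property

  module _ (geometry : IsNConvexGeometry G) where

    -- Were all extreme points of `K` in `L`, the hull, which is `K`, would be too. All later uses
    -- of `geometry` go through this separation.
    extreme-point-outside : ∀ {K L v} → NConvex G K → NConvex G L → v ∈ K → v ∉ L →
      ∃[ x ] ex G K x × x ∉ L
    extreme-point-outside {K} {L} convK convL v∈K v∉L
      with any? (λ x → ex? K x ×-dec ¬? (x ∈? L))
    ... | yes found = found
    ... | no none   = contradiction
          (proj₁ (geometry K convK) v∈K L convL
            λ {x} x∈ex → decidable-stable (x ∈? L) λ x∉L → none (x , x∈ex , x∉L))
          v∉L

    universal-unique : ∀ {u v} → Universal u → Universal v → u ≡ v
    universal-unique {u} {v} uu uv
      -- Separating from the empty set just produces some extreme point.
      with extreme-point-outside (common-NConvex ⊤) ⊥-NConvex (proj₂ ∈-universals uu) ∉⊥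
    ... | w , (w∈ , inj₂ empty) , _ = trans (≡w uu) (sym (≡w uv))
      where
      ≡w : ∀ {t} → Universal t → t ≡ w
      ≡w {t} ut = decidable-stable (t Fin.≟ w) λ t≢w →
        empty (t , x∈p∧x≢y⇒x∈p-y (proj₂ ∈-universals ut) t≢w)
    -- The universal vertex `w` lies in every N[Y], so N[Y] cannot be `universals - w`.
    ... | w , (w∈ , inj₁ (Y , _ , from)) , _ = contradiction
          (from λ {y} _ → N-sym (proj₁ ∈-universals w∈ y)) (x∉p-x universals w)

    second-extreme-point : ∀ {x y} → MissesOnly y x →
      ∃[ x′ ] x′ ≢ x × ∃[ y′ ] MissesOnly y′ x′
    second-extreme-point {x} {y} (¬Nyx , _)
      -- The set `common ⁅ x ⁆` is N[x], which contains `x` but not `y`.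
      with extreme-point-outside ⊤-NConvex (common-NConvex ⁅ x ⁆) (∈⊤ {x = y})
             (λ y∈ → ¬Nyx (N-sym (proj₁ (∈-comprehension (CommonN? ⁅ x ⁆)) y∈ (x∈⁅x⁆ x))))
    ... | x′ , x′∈ex , x′∉Nx with extreme-point x′∈ex
    ...   | inj₁ all≡  = contradiction (inj₁ (trans (all≡ x) (sym (all≡ y)))) ¬Nyx
    ...   | inj₂ found = x′ , x′≢x , found
      where
      x′≢x : x′ ≢ x
      x′≢x refl = x′∉Nx (proj₂ (∈-comprehension (CommonN? ⁅ x ⁆))
                          λ x∈ → inj₁ (sym (x∈⁅y⁆⇒x≡y x x∈)))

    vertices : ∀ {x y} → MissesOnly y x → (∀ {z} → Adj G x z → Universal z) →
      ∀ z → z ≡ x ⊎ z ≡ y ⊎ Universal z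
    vertices {x} {y} m@(¬Nyx , _) nbr z with second-extreme-point m
    ... | x′ , x′≢x , y′ , ¬Ny′x′ , Ny′ = locate (z Fin.≟ y)
      where
      -- Since `x` lies in N[y′], otherwise `y′` would be a neighbour of `x`, hence universal.
      y′≡x : y′ ≡ x
      y′≡x with Ny′ (x′≢x ∘ sym)
      ... | inj₁ eq = sym eq
      ... | inj₂ e  = contradiction (nbr (adj-sym G e) x′) ¬Ny′x′

      -- Otherwise `y` would lie in N[y′], which is N[x].
      x′≡y : x′ ≡ y
      x′≡y = decidable-stable (x′ Fin.≟ y) λ x′≢y →
        ¬Nyx (N-sym (subst (λ t → N[_] G t y) y′≡x (Ny′ (x′≢y ∘ sym))))

      locate : Dec (z ≡ y) → z ≡ x ⊎ z ≡ y ⊎ Universal z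
      locate (yes z≡y) = inj₂ (inj₁ z≡y)
      -- Now N[x] omits only `y`, so `z` is `x` or one of its neighbours.
      locate (no z≢y) with subst (λ t → N[_] G t z) y′≡x (Ny′ (λ z≡x′ → z≢y (trans z≡x′ x′≡y)))
      ... | inj₁ z≡x = inj₁ z≡x
      ... | inj₂ xz  = inj₂ (inj₂ (nbr xz))

    -- Identification of the three small graphs

    ≅K₁ : ∀ {x} → (∀ z → z ≡ x) → G ≅ K₁
    ≅K₁ {x} all≡ = matching⇒≅ G K₁ (λ _ → x) (λ { {0F} {0F} () }) (λ v → 0F , sym (all≡ v))

    -- The case depends on whether a universal vertex exists. If so, it is the middle of the path,
    -- and its uniqueness rules out a fourth vertex.
    ≅2K₁⊎P₃ : ∀ {x y} → MissesOnly y x → (∀ z → z ≡ x ⊎ z ≡ y ⊎ Universal z) →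
      G ≅ 2K₁ ⊎ G ≅ P₃
    ≅2K₁⊎P₃ {x} {y} (¬Nyx , _) cases with nonempty? universals
    ... | no none = inj₁ (matching⇒≅ G 2K₁ f match onto)
      where
      f = lookup (x ∷ y ∷ [])

      match : ∀ {i j} → i Fin.< j → Matches G 2K₁ f i j
      match {0F} {1F} _ = non-edge (¬Nyx ∘ inj₁) (¬Nyx ∘ inj₂ ∘ adj-sym G)
      match {1F} {1F} (s≤s ())

      onto : ∀ v → ∃[ i ] f i ≡ v
      onto v with cases v
      ... | inj₁ refl        = 0F , refl
      ... | inj₂ (inj₁ refl) = 1F , refl
      ... | inj₂ (inj₂ uv)   = contradiction (v , proj₂ ∈-universals uv) none
    ... | yes (u , u∈) = inj₂ (matching⇒≅ G P₃ f match onto)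
      where
      uu : Universal u
      uu = proj₁ ∈-universals u∈

      u-adj : ∀ {z} → u ≢ z → Adj G u z
      u-adj {z} u≢z with uu z
      ... | inj₁ z≡u = contradiction (sym z≡u) u≢z
      ... | inj₂ e   = e

      u≢x : u ≢ x
      u≢x refl = ¬Nyx (N-sym (uu y))

      u≢y : u ≢ y
      u≢y refl = ¬Nyx (uu x)

      f = lookup (x ∷ u ∷ y ∷ [])

      match : ∀ {i j} → i Fin.< j → Matches G P₃ f i j
      match {0F} {1F} _ = edge (adj-sym G (u-adj u≢x))
      match {0F} {2F} _ = non-edge (¬Nyx ∘ inj₁) (¬Nyx ∘ inj₂ ∘ adj-sym G)
      match {1F} {2F} _ = edge (u-adj u≢y)
      match {1F} {1F} (s≤s ())
      match {2F} {1F} (s≤s ())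
      match {2F} {2F} (s≤s (s≤s ()))

      onto : ∀ v → ∃[ i ] f i ≡ v
      onto v with cases v
      ... | inj₁ refl        = 0F , refl
      ... | inj₂ (inj₁ refl) = 2F , refl
      ... | inj₂ (inj₂ uv)   = 1F , universal-unique uu uv

    -- The disjunction form yields an explicit obstruction when there are four or more vertices. The
    -- `Fin n` argument witnesses that V is non-empty.
    obstructed-or-small : Fin n → Obstructed ⊎ Small
    obstructed-or-small v with extreme-point-outside ⊤-NConvex ⊥-NConvex (∈⊤ {x = v}) ∉⊥
    ... | x , x∈ex , _ with extreme-point x∈ex
    ...   | inj₁ all≡    = inj₂ (inj₁ (≅K₁ all≡))
    ...   | inj₂ (y , m) with neighbours-universal m
    ...     | inj₁ obstructed = inj₁ obstructed
    ...     | inj₂ nbr        = inj₂ (inj₂ (≅2K₁⊎P₃ m (vertices m nbr)))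

theorem44 : ∀ (n : ℕ) .{{_ : NonZero n}} (G : Graph (Fin n)) → IsNConvexGeometry G →
    (QuasiThreshold G ⇔ (G ≅ K₁ ⊎ G ≅ 2K₁ ⊎ G ≅ P₃)) ×
    ((G ≅ K₁ ⊎ G ≅ 2K₁ ⊎ G ≅ P₃) ⇔ Threshold G) ×
    (4 ≤ n → HasInduced G P₄ ⊎ HasInduced G C₄)
theorem44 n G geometry =
  mk⇔ quasiThreshold⇒small (threshold⇒quasiThreshold ∘ Small⇒Threshold G) ,
  mk⇔ (Small⇒Threshold G) (quasiThreshold⇒small ∘ threshold⇒quasiThreshold) ,
  λ 4≤n → [ id , (λ small → contradiction 4≤n (≤⇒≯ (Small⇒≤3 G small))) ] dichotomy
  where
  dichotomy : Obstructed G ⊎ Small G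
  dichotomy = obstructed-or-small G geometry (fromℕ< (>-nonZero⁻¹ n))

  quasiThreshold⇒small : QuasiThreshold G → Small G
  quasiThreshold⇒small (¬P₄ , ¬C₄) =
    [ [ (λ p → contradiction p ¬P₄) , (λ c → contradiction c ¬C₄) ] , id ] dichotomy

  threshold⇒quasiThreshold : Threshold G → QuasiThreshold G
  threshold⇒quasiThreshold (¬P₄ , ¬C₄ , _) = ¬P₄ , ¬C₄
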